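{- The only powers of $2$ that can be written as the sum of twenty-five or fewer distinct powers of $3$ are $$2^0 = 3^0,\qquad 2^2 = 3^0+3^1,\qquad 2^8 = 3^0+3^1+3^2+3^5.$$ That is, for an integer $x\ge 0$, there exist an integer $n$ with $1\le n\le 25$ and integers $0\le a_1<\cdots<a_n$ such that $$2^x = 3^{a_1}+\cdots+3^{a_n}$$ if and only if $x\in\{0,2,8\}$, and in these cases the representations are the ones displayed above.
   Context: A power of $2$ (respectively, of $3$) means an integer $2^a$ (respectively, $3^a$) with $a\ge 0$ an integer; in particular $1$ is a power of $2$ and a power of $3$. -}

module Defs where

open import Data.List using (List; length; map; sum)
open import Data.List.Relation.Unary.Linked using (Linked)
open import Data.Nat using (ℕ; _^_; _≤_; _<_)
open import Data.Product using (_×_)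
open import Relation.Binary.PropositionalEquality using (_≡_)

-- as = a₁ ∷ ⋯ ∷ aₙ ∷ [] lists the exponents of a representation
-- 2 ^ x = 3 ^ a₁ + ⋯ + 3 ^ aₙ with 1 ≤ n ≤ 25; Linked _<_ says a₁ < ⋯ < aₙ.
Representation : ℕ → List ℕ → Set
Representation x as =
    (1 ≤ length as × length as ≤ 25)
  × Linked _<_ as
  × 2 ^ x ≡ sum (map (3 ^_) as)

{-# OPTIONS --safe #-}
module Submission where

-- Let N = 2 ^ x be a sum of at most 25 distinct powers of 3. Its last k ternary digits are
-- then 0 or 1, and N / 3 ^ k is a sum of as many powers of 3 as remain. Folding modulo
-- 3 ^ d − 1 does not increase ternary digit sums, so the digit sum of the residue of N / 3 ^ k
-- is bounded too. This refutes whole residue classes of x modulo L whenever 2 has an order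
-- dividing L modulo 3 ^ k (3 ^ d − 1), up to powers of 2. For suitable d that order is
-- smooth, and refining L prime by prime refutes all x ≥ 21.

open import Data.Bool using (Bool; true; false; _∧_; _∨_; not; T)
open import Data.Bool.Properties using (T-∧; T-∨; T-≡)
open import Data.Empty using (⊥-elim)
open import Data.List using (List; []; _∷_; length; map)
open import Data.List.Relation.Unary.Linked using (Linked; []; [-]; _∷_)
open import Data.Nat using (ℕ; zero; suc; _+_; _*_; _∸_; _^_; _≤_; _<_; z≤n; s≤s; NonZero; _≤ᵇ_; _≡ᵇ_)
open import Data.Nat.DivMod
open import Data.Nat.Divisibility using (_∣_; divides-refl; m%n≡0⇒n∣m)
open import Data.Nat.Induction using (<-rec)
open import Data.Nat.ListAction using (sum)
open import Data.Nat.Properties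
open import Data.Nat.Tactic.RingSolver using (solve-∀)
open import Data.Product using (_×_; ∃; _,_; proj₁; proj₂)
open import Data.Sum using (_⊎_; inj₁; inj₂)
open import Data.Unit using (tt)
open import Function.Bundles using (_⇔_; mk⇔; Equivalence)
open import Relation.Binary using (tri<; tri≈; tri>)
open import Relation.Binary.PropositionalEquality using (_≡_; refl; sym; trans; cong; cong₂; subst)
open import Relation.Nullary using (¬_)
open import Relation.Nullary.Decidable using (toWitness; T?; _→-dec_; _⊎-dec_)
open import Defs

-- Ternary digits and digit sums.

_/3^_ : ℕ → ℕ → ℕ
n /3^ k = (n / 3 ^ k) {{m^n≢0 3 k}}

-- Only the lowest `f` ternary digits are read; bounds on the full digit sum leave `f` arbitrary.
digitSum : ℕ → ℕ → ℕ
digitSum zero    n = 0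
digitSum (suc f) n = n % 3 + digitSum f (n / 3)

binaryDigits : ℕ → ℕ → Bool
binaryDigits zero    n = true
binaryDigits (suc f) n = (n % 3 ≤ᵇ 1) ∧ binaryDigits f (n / 3)

+-*-/ : ∀ m k n .{{_ : NonZero n}} → (m + k * n) / n ≡ m / n + k
+-*-/ m k n = trans (+-distrib-/-∣ʳ m (divides-refl k)) (cong (m / n +_) (m*n/n≡m k n))

module _ (f u X : ℕ) where
  private
    shift : u + X * 3 ^ suc f ≡ u + (X * 3 ^ f) * 3
    shift = lemma u X (3 ^ f)
      where
      lemma : ∀ a b c → a + b * (3 * c) ≡ a + (b * c) * 3
      lemma = solve-∀

  high-% : (u + X * 3 ^ suc f) % 3 ≡ u % 3
  high-% = trans (cong (_% 3) shift) ([m+kn]%n≡m%n u (X * 3 ^ f) 3)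

  high-/ : (u + X * 3 ^ suc f) / 3 ≡ u / 3 + X * 3 ^ f
  high-/ = trans (cong (_/ 3) shift) (+-*-/ u (X * 3 ^ f) 3)

digitSum-low : ∀ f u X → digitSum f (u + X * 3 ^ f) ≡ digitSum f u
digitSum-low zero    u X = refl
digitSum-low (suc f) u X = cong₂ _+_ (high-% f u X)
  (trans (cong (digitSum f) (high-/ f u X)) (digitSum-low f (u / 3) X))

binaryDigits-low : ∀ f u X → binaryDigits f (u + X * 3 ^ f) ≡ binaryDigits f u
binaryDigits-low zero    u X = refl
binaryDigits-low (suc f) u X = cong₂ _∧_ (cong (_≤ᵇ 1) (high-% f u X))
  (trans (cong (binaryDigits f) (high-/ f u X)) (binaryDigits-low f (u / 3) X))

digitSum-split : ∀ k f n → digitSum (k + f) n ≡ digitSum k n + digitSum f (n /3^ k)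
digitSum-split zero    f n = cong (digitSum f) (sym (n/1≡n n))
digitSum-split (suc k) f n = trans
  (cong (n % 3 +_) (trans (digitSum-split k f (n / 3))
    (cong (λ h → digitSum k (n / 3) + digitSum f h) (m/n/o≡m/[n*o] n 3 (3 ^ k) {{_}} {{m^n≢0 3 k}} {{m^n≢0 3 (suc k)}}))))
  (sym (+-assoc (n % 3) _ _))

digitSum-≤ : ∀ f n → digitSum f n ≤ n
digitSum-≤ zero    n = z≤n
digitSum-≤ (suc f) n = begin
  n % 3 + digitSum f (n / 3) ≤⟨ +-monoʳ-≤ (n % 3) (digitSum-≤ f (n / 3)) ⟩
  n % 3 + n / 3              ≤⟨ +-monoʳ-≤ (n % 3) (m≤m*n (n / 3) 3) ⟩
  n % 3 + n / 3 * 3          ≡⟨ m≡m%n+[m/n]*n n 3 ⟨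
  n                          ∎
  where open ≤-Reasoning

-- A carry trades three units for one unit in the next position, so it never raises the digit sum.
digitSum-+ : ∀ f a b → digitSum f (a + b) ≤ digitSum f a + digitSum f b
digitSum-+ zero    a b = z≤n
digitSum-+ (suc f) a b = begin
  (a + b) % 3 + digitSum f ((a + b) / 3)
    ≡⟨ cong₂ (λ x y → x + digitSum f y) (trans (cong (_% 3) regroup) ([m+kn]%n≡m%n c (p + q) 3))
                                        (trans (cong (_/ 3) regroup) (+-*-/ c (p + q) 3)) ⟩
  c % 3 + digitSum f (c / 3 + (p + q))
    ≤⟨ +-monoʳ-≤ (c % 3) (digitSum-+ f (c / 3) (p + q)) ⟩
  c % 3 + (digitSum f (c / 3) + digitSum f (p + q))
    ≤⟨ +-monoʳ-≤ (c % 3) (+-mono-≤ (≤-trans (digitSum-≤ f (c / 3)) (m≤m*n (c / 3) 3)) (digitSum-+ f p q)) ⟩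
  c % 3 + (c / 3 * 3 + (digitSum f p + digitSum f q))
    ≡⟨ +-assoc (c % 3) (c / 3 * 3) _ ⟨
  c % 3 + c / 3 * 3 + (digitSum f p + digitSum f q)
    ≡⟨ cong (_+ (digitSum f p + digitSum f q)) (m≡m%n+[m/n]*n c 3) ⟨
  a % 3 + b % 3 + (digitSum f p + digitSum f q)
    ≡⟨ interchange (a % 3) (b % 3) _ _ ⟩
  a % 3 + digitSum f p + (b % 3 + digitSum f q) ∎
  where
  open ≤-Reasoning
  c = a % 3 + b % 3
  p = a / 3
  q = b / 3
  interchange : ∀ x y z w → x + y + (z + w) ≡ x + z + (y + w)
  interchange = solve-∀
  gather : ∀ x y z w → x + y * 3 + (z + w * 3) ≡ x + z + (y + w) * 3
  gather = solve-∀
  regroup : a + b ≡ c + (p + q) * 3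
  regroup = trans (cong₂ _+_ (m≡m%n+[m/n]*n a 3) (m≡m%n+[m/n]*n b 3)) (gather (a % 3) p (b % 3) q)

digitSum-zero : ∀ f → digitSum f 0 ≡ 0
digitSum-zero zero    = refl
digitSum-zero (suc f) = digitSum-zero f

digitSum-complete : ∀ d f n → n < 3 ^ d → digitSum f n ≤ digitSum d n
digitSum-complete zero    f       zero n<1 = ≤-reflexive (digitSum-zero f)
digitSum-complete zero    f (suc n) (s≤s ())
digitSum-complete (suc d) zero    n    n<  = z≤n
digitSum-complete (suc d) (suc f) n    n<  = +-monoʳ-≤ (n % 3)
  (digitSum-complete d f (n / 3) (m<n*o⇒m/o<n (subst (n <_) (*-comm 3 (3 ^ d)) n<)))

-- Folding modulo 3 ^ d - 1.

-- For positive `d` this is 3 ^ d - 1, whose ternary digits are all 2; the outer `suc` makes it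
-- visibly nonzero.
repdigit : ℕ → ℕ
repdigit d = suc (3 ^ d ∸ 2)

1+repdigit : ∀ d .{{_ : NonZero d}} → suc (repdigit d) ≡ 3 ^ d
1+repdigit (suc d) = m+[n∸m]≡n (≤-trans (n≤1+n 2) (^-monoʳ-≤ 3 (s≤s (z≤n {d}))))

-- Positive numbers are represented modulo 3 ^ d ∸ 1 by 1, …, 3 ^ d ∸ 1, so that a
-- positive multiple of the modulus keeps its digit sum 2 d instead of collapsing to 0.
digitSum-fold : ∀ d .{{_ : NonZero d}} s f → ∃ λ f′ →
                digitSum f (suc (s % repdigit d)) ≤ digitSum f′ (suc s)
digitSum-fold d = <-rec _ step
  where
  open ≤-Reasoning
  M = repdigit d
  instance _ = m^n≢0 3 d
  step : ∀ s → (∀ {s′} → s′ < s → ∀ f → ∃ λ f′ → digitSum f (suc (s′ % M)) ≤ digitSum f′ (suc s′)) →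
         ∀ f → ∃ λ f′ → digitSum f (suc (s % M)) ≤ digitSum f′ (suc s)
  step s rec f with <-≤-connex s M
  ... | inj₁ s<M = f , ≤-reflexive (cong (λ r → digitSum f (suc r)) (m<n⇒m%n≡m s<M))
  ... | inj₂ M≤s = fold (suc s / 3 ^ d) refl
    where
    r = suc s % 3 ^ d
    3^d≤1+s : 3 ^ d ≤ suc s
    3^d≤1+s = subst (_≤ suc s) (1+repdigit d) (s≤s M≤s)
    fold : ∀ q → suc s / 3 ^ d ≡ q → ∃ λ f′ → digitSum f (suc (s % M)) ≤ digitSum f′ (suc s)
    fold zero    eq = ⊥-elim (<⇒≢ (m≥n⇒m/n>0 3^d≤1+s) (sym eq))
    -- Since 3 ^ d ≡ 1 modulo `M`, `r + suc q` is congruent to `suc s`; it is smaller, and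
    -- subadditivity bounds its digit sum.
    fold (suc q) eq = d + f₁ , (begin
      digitSum f (suc (s % M))                  ≡⟨ cong (λ x → digitSum f (suc x)) s%M ⟩
      digitSum f (suc ((r + q) % M))            ≤⟨ proj₂ ih ⟩
      digitSum f₁ (suc (r + q))                 ≡⟨ cong (digitSum f₁) (+-suc r q) ⟨
      digitSum f₁ (r + suc q)                   ≤⟨ digitSum-+ f₁ r (suc q) ⟩
      digitSum f₁ r + digitSum f₁ (suc q)       ≤⟨ +-monoˡ-≤ _ (digitSum-complete d f₁ r (m%n<n (suc s) (3 ^ d))) ⟩
      digitSum d r + digitSum f₁ (suc q)        ≡⟨ cong (_+ digitSum f₁ (suc q)) (digitSum-low d r (suc q)) ⟨
      digitSum d (r + suc q * 3 ^ d) + digitSum f₁ (suc q)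
        ≡⟨ cong₂ (λ x y → digitSum d x + digitSum f₁ y) (sym decompose) (sym eq) ⟩
      digitSum d (suc s) + digitSum f₁ (suc s / 3 ^ d) ≡⟨ digitSum-split d f₁ (suc s) ⟨
      digitSum (d + f₁) (suc s)                 ∎)
      where
      decompose : suc s ≡ r + suc q * 3 ^ d
      decompose = trans (m≡m%n+[m/n]*n (suc s) (3 ^ d)) (cong (λ x → r + x * 3 ^ d) eq)
      rearrange : ∀ a b m → a + (1 + b) * (1 + m) ≡ 1 + (a + b + (1 + b) * m)
      rearrange = solve-∀
      s≡ : s ≡ r + q + suc q * M
      s≡ = suc-injective (trans decompose
        (trans (cong (λ x → r + suc q * x) (sym (1+repdigit d))) (rearrange r q M)))
      s%M : s % M ≡ (r + q) % M
      s%M = trans (cong (_% M) s≡) ([m+kn]%n≡m%n (r + q) (suc q) M)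
      ih = rec (subst (r + q <_) (sym s≡) (m<m+n (r + q) (s≤s z≤n))) f
      f₁ = proj₁ ih

-- Numbers with ternary digits 0 and 1.

-- The first index counts the digits 1 of the second, whose lowest digit is the outermost; leading
-- zeros are harmless.
data BinarySum : ℕ → ℕ → Set where
  nil  : BinarySum 0 0
  cons : ∀ {b w n} → b ≤ 1 → BinarySum w n → BinarySum (b + w) (b + n * 3)

module _ {b : ℕ} (b≤1 : b ≤ 1) (n : ℕ) where
  cons-% : (b + n * 3) % 3 ≡ b
  cons-% = trans ([m+kn]%n≡m%n b n 3) (m<n⇒m%n≡m (s≤s (≤-trans b≤1 (n≤1+n 1))))

  cons-/ : (b + n * 3) / 3 ≡ n
  cons-/ = trans (+-*-/ b n 3) (cong (_+ n) (m<n⇒m/n≡0 (s≤s (≤-trans b≤1 (n≤1+n 1)))))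

digitSum-BinarySum : ∀ {w n} → BinarySum w n → ∀ f → digitSum f n ≤ w
digitSum-BinarySum nil f = ≤-reflexive (digitSum-zero f)
digitSum-BinarySum (cons b≤1 p) zero = z≤n
digitSum-BinarySum (cons {n = n} b≤1 p) (suc f)
  rewrite cons-% b≤1 n | cons-/ b≤1 n = +-monoʳ-≤ _ (digitSum-BinarySum p f)

binaryDigits-BinarySum : ∀ {w n} → BinarySum w n → ∀ f → T (binaryDigits f n)
binaryDigits-BinarySum nil zero = tt
binaryDigits-BinarySum nil (suc f) = binaryDigits-BinarySum nil f
binaryDigits-BinarySum (cons b≤1 p) zero = tt
binaryDigits-BinarySum (cons {n = n} b≤1 p) (suc f)
  rewrite cons-% b≤1 n | cons-/ b≤1 n
  = Equivalence.from T-∧ (≤⇒≤ᵇ b≤1 , binaryDigits-BinarySum p f)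

BinarySum-shift : ∀ e {w n} → BinarySum w n → BinarySum w (n * 3 ^ e)
BinarySum-shift zero    {n = n} p = subst (BinarySum _) (sym (*-identityʳ n)) p
BinarySum-shift (suc e) {n = n} p =
  subst (BinarySum _) (lemma n (3 ^ e)) (cons z≤n (BinarySum-shift e p))
  where
  lemma : ∀ a b → a * b * 3 ≡ a * (3 * b)
  lemma = solve-∀

-- Sums of distinct powers of 3 and their uniqueness.

powerSum : List ℕ → ℕ
powerSum as = sum (map (3 ^_) as)

-- The later exponents exceed `a`, so after division by 3 ^ a they contribute a multiple of 3. This
-- yields both the digit structure and uniqueness.
powerSum-head : ∀ {a as} → Linked _<_ (a ∷ as) →
                ∃ λ n → BinarySum (length as) n × powerSum (a ∷ as) ≡ (1 + n * 3) * 3 ^ a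
powerSum-head {a} [-] = 0 , nil , refl
powerSum-head {a} {b ∷ as} (a<b ∷ ls) with powerSum-head ls | m≤n⇒∃[o]m+o≡n a<b
... | n , p , eq | e , refl = (1 + n * 3) * 3 ^ e , BinarySum-shift e (cons (s≤s z≤n) p) ,
  (begin
    3 ^ a + powerSum (b ∷ as)                 ≡⟨ cong (3 ^ a +_) eq ⟩
    3 ^ a + (1 + n * 3) * (3 * 3 ^ (a + e))   ≡⟨ cong (λ x → 3 ^ a + (1 + n * 3) * (3 * x)) (^-distribˡ-+-* 3 a e) ⟩
    3 ^ a + (1 + n * 3) * (3 * (3 ^ a * 3 ^ e)) ≡⟨ lemma (3 ^ a) (1 + n * 3) (3 ^ e) ⟩
    (1 + (1 + n * 3) * 3 ^ e * 3) * 3 ^ a ∎)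
  where
  open Relation.Binary.PropositionalEquality.≡-Reasoning
  lemma : ∀ x y z → x + y * (3 * (x * z)) ≡ (1 + y * z * 3) * x
  lemma = solve-∀

powerSum-BinarySum : ∀ {as} → Linked _<_ as → BinarySum (length as) (powerSum as)
powerSum-BinarySum []  = nil
powerSum-BinarySum {a ∷ as} ls@[-] with powerSum-head ls
... | n , p , eq = subst (BinarySum _) (sym eq) (BinarySum-shift a (cons (s≤s z≤n) p))
powerSum-BinarySum {a ∷ as} ls@(_ ∷ _) with powerSum-head ls
... | n , p , eq = subst (BinarySum _) (sym eq) (BinarySum-shift a (cons (s≤s z≤n) p))

powerSum-positive : ∀ a as → 0 < powerSum (a ∷ as)
powerSum-positive a as = ≤-trans (m^n>0 3 a) (m≤m+n (3 ^ a) _)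

-- Divided by 3 ^ a, the left sum is 1 modulo 3, whereas for `a < b` the right one is a multiple of
-- 3.
heads-≮ : ∀ {a b as bs} → Linked _<_ (a ∷ as) → Linked _<_ (b ∷ bs) →
          powerSum (a ∷ as) ≡ powerSum (b ∷ bs) → ¬ a < b
heads-≮ {a} la lb eq a<b with powerSum-head la | powerSum-head lb | m≤n⇒∃[o]m+o≡n a<b
... | n , _ , eqa | m , _ , eqb | e , refl
  with trans (sym (cons-% (s≤s z≤n) n)) (trans (cong (_% 3) cancelled) (cons-% z≤n ((1 + m * 3) * 3 ^ e)))
  where
  lemma : ∀ x y z → y * (3 * (x * z)) ≡ (y * z * 3) * x
  lemma = solve-∀
  cancelled : 1 + n * 3 ≡ (1 + m * 3) * 3 ^ e * 3
  cancelled = *-cancelʳ-≡ _ _ (3 ^ a) {{m^n≢0 3 a}} (trans (sym eqa) (trans eq (trans eqb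
    (trans (cong (λ x → (1 + m * 3) * (3 * x)) (^-distribˡ-+-* 3 a e)) (lemma (3 ^ a) (1 + m * 3) (3 ^ e))))))
... | ()

Linked-tail : ∀ {a as} → Linked _<_ (a ∷ as) → Linked _<_ as
Linked-tail [-]      = []
Linked-tail (_ ∷ ls) = ls

powerSum-injective : ∀ {as bs} → Linked _<_ as → Linked _<_ bs → powerSum as ≡ powerSum bs → as ≡ bs
powerSum-injective {[]}     {[]}     la lb eq = refl
powerSum-injective {[]}     {b ∷ bs} la lb eq = ⊥-elim (<⇒≢ (powerSum-positive b bs) eq)
powerSum-injective {a ∷ as} {[]}     la lb eq = ⊥-elim (<⇒≢ (powerSum-positive a as) (sym eq))
powerSum-injective {a ∷ as} {b ∷ bs} la lb eq with <-cmp a b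
... | tri< a<b _ _ = ⊥-elim (heads-≮ la lb eq a<b)
... | tri> _ _ b<a = ⊥-elim (heads-≮ lb la (sym eq) b<a)
... | tri≈ _ refl _ = cong (a ∷_)
  (powerSum-injective (Linked-tail la) (Linked-tail lb) (+-cancelˡ-≡ (3 ^ a) _ _ eq))

-- Congruences and the sieve.

*-cong-% : ∀ n .{{_ : NonZero n}} {a b c d} → a % n ≡ b % n → c % n ≡ d % n → (a * c) % n ≡ (b * d) % n
*-cong-% n {a} {b} {c} {d} a≡b c≡d = trans (%-distribˡ-* a c n)
  (trans (cong₂ (λ x y → (x * y) % n) a≡b c≡d) (sym (%-distribˡ-* b d n)))

^-cong-% : ∀ n .{{_ : NonZero n}} e {a b} → a % n ≡ b % n → (a ^ e) % n ≡ (b ^ e) % n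
^-cong-% n zero    a≡b = refl
^-cong-% n (suc e) a≡b = *-cong-% n a≡b (^-cong-% n e a≡b)

-- One level of the search: a node splits into `branching` children, tested modulo 3 ^ `lowDigits` *
-- (3 ^ `period` - 1).
record Stage : Set where
  constructor _⟨_,_⟩
  field
    branching lowDigits period : ℕ

-- A node (v , g) of the search tree stands for the numbers congruent to v * g ^ t modulo Q
-- for some t; its q children (v * g ^ r , g ^ q) with r < q fix the residue of t modulo q.
-- A modulus m dividing Q is usable at a node if v * g ≡ v modulo m: then the number itself
-- is determined modulo m, and no multiplicative order has to be known.
module Sieve (Q : ℕ) .{{_ : NonZero Q}} (lower budget : ℕ) where

  -- Here `u` is a residue modulo `modulus k d`, so `u /3^ k` is the high part modulo 3 ^ d - 1. For
  -- positive `d`, `3 ^ d ∸ 2` is -1 there, and the `suc` picks the representative in 1, ..., 3 ^ d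
  -- - 1.
  fits : ℕ → ℕ → ℕ → Bool
  fits k d u = binaryDigits k u ∧
    (digitSum k u + digitSum d (suc ((u /3^ k + (3 ^ d ∸ 2)) % repdigit d)) ≤ᵇ budget)

  modulus : ℕ → ℕ → ℕ
  modulus k d = 3 ^ k * repdigit d

  modulus-nonZero : ∀ k d → NonZero (modulus k d)
  modulus-nonZero k d = m*n≢0 (3 ^ k) (repdigit d) {{m^n≢0 3 k}}

  _mod⟨_,_⟩ : ℕ → ℕ → ℕ → ℕ
  n mod⟨ k , d ⟩ = (n % modulus k d) {{modulus-nonZero k d}}

  -- The test against `lower` guarantees a positive high part, which the choice of representatives
  -- requires.
  refutes : ℕ → ℕ → ℕ → ℕ → Bool
  refutes k zero      v g = false
  refutes k d@(suc _) v g =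
    (3 ^ k ≤ᵇ lower) ∧ ((Q mod⟨ k , d ⟩ ≡ᵇ 0) ∧
    (((v * g) mod⟨ k , d ⟩ ≡ᵇ v mod⟨ k , d ⟩) ∧ not (fits k d (v mod⟨ k , d ⟩))))

  mutual
    closed : List Stage → ℕ → ℕ → Bool
    closed []                               v g = false
    closed ((zero ⟨ k , d ⟩) ∷ stages)      v g = false
    closed ((q@(suc _) ⟨ k , d ⟩) ∷ stages) v g = branches stages k d q v g (g ^ q % Q)

    -- `q` counts the children left, `v` runs through their starting values, and `h` is their common
    -- ratio, computed once.
    branches : List Stage → ℕ → ℕ → ℕ → ℕ → ℕ → ℕ → Bool
    branches stages k d zero    v g h = true
    branches stages k d (suc q) v g h =
      (refutes k d v h ∨ closed stages v h) ∧ branches stages k d q (v * g % Q) g h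

  module _ {w N : ℕ} (N-sum : BinarySum w N) (w≤budget : w ≤ budget) (lower≤N : lower ≤ N) where

    -- Removing multiples of the modulus keeps the low `k` digits and alters the high part by
    -- multiples of `M`; splitting the digit sum at `k` and folding the high part give the bound.
    fits-complete : ∀ k d .{{_ : NonZero d}} → 3 ^ k ≤ N → T (fits k d (N mod⟨ k , d ⟩))
    fits-complete k d 3^k≤N = positive (N /3^ k) refl
      where
      open ≤-Reasoning
      instance
        _ = m^n≢0 3 k
        _ = modulus-nonZero k d
      M = repdigit d
      u = N mod⟨ k , d ⟩
      t = N / modulus k d
      decompose : N ≡ u + t * M * 3 ^ k
      decompose = trans (m≡m%n+[m/n]*n N (modulus k d)) (lemma u t (3 ^ k) M)
        where
        lemma : ∀ u t p m → u + t * (p * m) ≡ u + t * m * p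
        lemma = solve-∀
      binary : T (binaryDigits k u)
      binary = subst T (trans (cong (binaryDigits k) decompose) (binaryDigits-low k u (t * M)))
        (binaryDigits-BinarySum N-sum k)
      sum-low : digitSum k N ≡ digitSum k u
      sum-low = trans (cong (digitSum k) decompose) (digitSum-low k u (t * M))
      positive : ∀ h → N /3^ k ≡ h → T (fits k d u)
      positive zero    eq = ⊥-elim (<⇒≢ (m≥n⇒m/n>0 3^k≤N) (sym eq))
      positive (suc h) eq = Equivalence.from T-∧ (binary , ≤⇒≤ᵇ (begin
        digitSum k u + digitSum d (suc ((a + (3 ^ d ∸ 2)) % M)) ≡⟨ cong₂ (λ x y → x + digitSum d (suc y)) (sym sum-low) residue ⟩
        digitSum k N + digitSum d (suc (h % M)) ≤⟨ +-monoʳ-≤ _ (proj₂ folded) ⟩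
        digitSum k N + digitSum f (suc h)       ≡⟨ cong (λ x → digitSum k N + digitSum f x) eq ⟨
        digitSum k N + digitSum f (N /3^ k)     ≡⟨ digitSum-split k f N ⟨
        digitSum (k + f) N                      ≤⟨ digitSum-BinarySum N-sum (k + f) ⟩
        w                                       ≤⟨ w≤budget ⟩
        budget                                  ∎))
        where
        a = u /3^ k
        folded = digitSum-fold d h d
        f = proj₁ folded
        lemma : ∀ a m x → a + m + x ≡ a + x + m
        lemma = solve-∀
        -- As `N /3^ k` is `suc h`, adding `3 ^ d ∸ 2` to it gives `h + M`.
        residue : (a + (3 ^ d ∸ 2)) % M ≡ h % M
        residue = trans (sym ([m+kn]%n≡m%n (a + (3 ^ d ∸ 2)) t M))
          (trans (cong (_% M) (trans (lemma a (3 ^ d ∸ 2) (t * M))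
            (trans (cong (_+ (3 ^ d ∸ 2)) (trans (sym (+-*-/ u (t * M) (3 ^ k))) (trans (cong (_/3^ k) (sym decompose)) eq)))
              (sym (+-suc h (3 ^ d ∸ 2))))))
          ([m+n]%n≡m%n h M))

    refutes-sound : ∀ k d v g t → T (refutes k d v g) → ¬ N % Q ≡ (v * g ^ t) % Q
    refutes-sound k d@(suc _) v g t r N≡ with Equivalence.to (T-∧ {3 ^ k ≤ᵇ lower}) r
    ... | 3^k≤ , r₁ with Equivalence.to (T-∧ {Q mod⟨ k , d ⟩ ≡ᵇ 0}) r₁
    ... | m∣Q? , r₂ with Equivalence.to (T-∧ {(v * g) mod⟨ k , d ⟩ ≡ᵇ v mod⟨ k , d ⟩}) r₂
    ... | fixed? , r₃ = subst T (trans (cong (λ u → not (fits k d u)) (sym N≡v)) (cong not fit)) r₃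
      where
      instance _ = modulus-nonZero k d
      m = modulus k d
      m∣Q : m ∣ Q
      m∣Q = m%n≡0⇒n∣m Q m (≡ᵇ⇒≡ _ _ m∣Q?)
      -- Modulo `m`, `v` absorbs one factor `g`, hence any power of it.
      fixed : ∀ t → (v * g ^ t) % m ≡ v % m
      fixed zero    = cong (_% m) (*-identityʳ v)
      fixed (suc t) = trans (cong (_% m) (sym (*-assoc v g (g ^ t))))
        (trans (*-cong-% m (≡ᵇ⇒≡ ((v * g) % m) (v % m) fixed?) refl) (fixed t))
      N≡v : N % m ≡ v % m
      N≡v = trans (sym (m∣n⇒o%n%m≡o%m m Q N m∣Q))
        (trans (cong (_% m) N≡) (trans (m∣n⇒o%n%m≡o%m m Q (v * g ^ t) m∣Q) (fixed t)))
      fit : fits k d (N mod⟨ k , d ⟩) ≡ true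
      fit = Equivalence.to T-≡ (fits-complete k d (≤-trans (≤ᵇ⇒≤ _ _ 3^k≤) lower≤N))

    mutual
      closed-sound : ∀ stages v g → T (closed stages v g) → ∀ t → ¬ N % Q ≡ (v * g ^ t) % Q
      closed-sound ((q@(suc _) ⟨ k , d ⟩) ∷ stages) v g c t N≡ =
        branches-sound stages k d q v g (g ^ q % Q) c (t % q) (t / q) (m%n<n t q)
          (trans N≡ (trans (cong (λ x → (v * x) % Q) split)
            (trans (cong (_% Q) (sym (*-assoc v (g ^ (t % q)) _)))
              (*-cong-% Q {a = v * g ^ (t % q)} refl (^-cong-% Q (t / q) (sym (m%n%n≡m%n (g ^ q) Q)))))))
        where
        -- The child is selected by `t % q`; `t / q` becomes the exponent of its ratio.
        split : g ^ t ≡ g ^ (t % q) * (g ^ q) ^ (t / q)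
        split = trans (cong (g ^_) (trans (m≡m%n+[m/n]*n t q) (cong (t % q +_) (*-comm (t / q) q))))
          (trans (^-distribˡ-+-* g (t % q) (q * (t / q))) (cong (g ^ (t % q) *_) (sym (^-*-assoc g q (t / q)))))

      branches-sound : ∀ stages k d q v g h → T (branches stages k d q v g h) →
                       ∀ r s → r < q → ¬ N % Q ≡ (v * g ^ r * h ^ s) % Q
      branches-sound stages k d (suc q) v g h b r s r<q N≡
        with Equivalence.to (T-∧ {refutes k d v h ∨ closed stages v h}) b
      branches-sound stages k d (suc q) v g h b zero s r<q N≡ | here , _
        with Equivalence.to (T-∨ {refutes k d v h}) here | trans N≡ (cong (λ x → (x * h ^ s) % Q) (*-identityʳ v))
      ... | inj₁ refuted | N≡′ = refutes-sound k d v h s refuted N≡′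
      ... | inj₂ c       | N≡′ = closed-sound stages v h c s N≡′
      branches-sound stages k d (suc q) v g h b (suc r) s (s≤s r<q) N≡ | _ , rest =
        branches-sound stages k d q (v * g % Q) g h rest r s r<q
          (trans N≡ (*-cong-% Q (trans (cong (_% Q) (sym (*-assoc v g (g ^ r))))
            (*-cong-% Q (sym (m%n%n≡m%n (v * g) Q)) refl)) refl))

-- Powers of 2: the search and the small cases.

powers-of-2-excluded : ∀ Q .{{_ : NonZero Q}} ℓ budget stages →
                       Sieve.closed Q (2 ^ ℓ) budget stages (2 ^ ℓ) 2 ≡ true →
                       ∀ {w x} → ℓ ≤ x → w ≤ budget → ¬ BinarySum w (2 ^ x)
powers-of-2-excluded Q ℓ budget stages c {x = x} ℓ≤x w≤budget N-sum =
  Sieve.closed-sound Q (2 ^ ℓ) budget N-sum w≤budget (^-monoʳ-≤ 2 ℓ≤x) stages (2 ^ ℓ) 2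
    (Equivalence.from T-≡ c) (x ∸ ℓ)
    (cong (_% Q) (trans (cong (2 ^_) (sym (m+[n∸m]≡n ℓ≤x))) (^-distribˡ-+-* 2 ℓ (x ∸ ℓ))))

-- 3 ^ 13 * (3 ^ 144 ∸ 1), a common multiple of the moduli of the stages, as a visible successor.
bigModulus : ℕ
bigModulus = suc (3 ^ 157 ∸ 3 ^ 13 ∸ 1)

-- The odd part of 3 ^ d ∸ 1 gives 2 the order 4 · 3³ · 7, 4 · 3⁶ · 7 · 13, 2⁷ · 3⁴ · 5 and
-- 4 · 3¹² · 5 · 7 · 13 · 73 for d = 18, 36, 48 and 72. The factor 3¹² is essential: 2²⁰, 2²⁴
-- and 2²⁶ have small digit sums and no ternary digit 2 before positions 7, 10 and 10, so that
-- their residue classes survive every modulus whose order has too small a 3-part.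
stages : List Stage
stages = (1458 ⟨ 7 , 1 ⟩) ∷ (14 ⟨ 7 , 18 ⟩) ∷ (13 ⟨ 7 , 36 ⟩) ∷ (160 ⟨ 7 , 48 ⟩)
       ∷ (729 ⟨ 13 , 1 ⟩) ∷ (73 ⟨ 13 , 72 ⟩) ∷ []

-- Holds by evaluation. The start 2 ^ 21 is at least 3 ^ 13, as 13 low digits demand, and is
-- divisible by the power of 2 in each modulus.
search-closed : Sieve.closed bigModulus (2 ^ 21) 25 stages (2 ^ 21) 2 ≡ true
search-closed = refl

-- Since 2 ^ 20 < 3 ^ 13, all digits are inspected; every other exponent below 21 produces a digit
-- 2.
small-exponents : ∀ {x} → x < 21 → T (binaryDigits 13 (2 ^ x)) → x ≡ 0 ⊎ x ≡ 2 ⊎ x ≡ 8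
small-exponents = toWitness {a? = allUpTo? (λ x →
  T? (binaryDigits 13 (2 ^ x)) →-dec (x ≟ 0 ⊎-dec x ≟ 2 ⊎-dec x ≟ 8)) 21} tt

exponents : ∀ {x as} → Representation x as → x ≡ 0 ⊎ x ≡ 2 ⊎ x ≡ 8
exponents {x} {as} ((_ , n≤25) , linked , eq) with <-≤-connex x 21
... | inj₁ x<21 = small-exponents x<21
  (binaryDigits-BinarySum (subst (BinarySum (length as)) (sym eq) (powerSum-BinarySum linked)) 13)
... | inj₂ 21≤x = ⊥-elim (powers-of-2-excluded bigModulus 21 25 stages search-closed 21≤x n≤25
  (subst (BinarySum (length as)) (sym eq) (powerSum-BinarySum linked)))

representation-unique : ∀ {x as bs} → Representation x as → (Representation x bs ⇔ bs ≡ as)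
representation-unique p@(_ , la , eqa) = mk⇔
  (λ { (_ , lb , eqb) → powerSum-injective lb la (trans (sym eqb) eqa) })
  λ { refl → p }

represents-0 : Representation 0 (0 ∷ [])
represents-0 = (s≤s z≤n , ≤ᵇ⇒≤ 1 25 tt) , [-] , refl

represents-2 : Representation 2 (0 ∷ 1 ∷ [])
represents-2 = (s≤s z≤n , ≤ᵇ⇒≤ 2 25 tt) , ≤ᵇ⇒≤ 1 1 tt ∷ [-] , refl

represents-8 : Representation 8 (0 ∷ 1 ∷ 2 ∷ 5 ∷ [])
represents-8 = (s≤s z≤n , ≤ᵇ⇒≤ 4 25 tt) , ≤ᵇ⇒≤ 1 1 tt ∷ ≤ᵇ⇒≤ 2 2 tt ∷ ≤ᵇ⇒≤ 3 5 tt ∷ [-] , refl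

theorem1p2 : (∀ (x : ℕ) → (∃ λ (as : List ℕ) → Representation x as) ⇔ (x ≡ 0 ⊎ x ≡ 2 ⊎ x ≡ 8))
    × (∀ (as : List ℕ) → Representation 0 as ⇔ as ≡ 0 ∷ [])
    × (∀ (as : List ℕ) → Representation 2 as ⇔ as ≡ 0 ∷ 1 ∷ [])
    × (∀ (as : List ℕ) → Representation 8 as ⇔ as ≡ 0 ∷ 1 ∷ 2 ∷ 5 ∷ [])
theorem1p2 =
    (λ x → mk⇔ (λ { (_ , p) → exponents p })
      λ { (inj₁ refl)        → _ , represents-0
        ; (inj₂ (inj₁ refl)) → _ , represents-2
        ; (inj₂ (inj₂ refl)) → _ , represents-8 })
  , (λ as → representation-unique {0} represents-0)
  , (λ as → representation-unique {2} represents-2)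
  , (λ as → representation-unique {8} represents-8)
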